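{- A reflexive oriented graph $D$ is transitive if and only if $G=\mathrm{Split}(D)$ is WDI. Furthermore, if $G$ is WDI, then the perfect matching $M=\{\mathrm{out}(v)\to\mathrm{in}(v)\mid v\in V(D)\}$ is exactly the set of disimplicial arcs of $G$.
   Context: A digraph is a finite vertex set $V$ with arc set $E\subseteq V\times V$ (loops allowed). $D$ is reflexive if $v\to v\in E$ for all $v$; oriented if $v\to w$ and $w\to v$ are both arcs only when $v=w$; a vertex $v$ is transitive if $x\to y$ is an arc for every in-neighbor $x$ and out-neighbor $y$ of $v$, and $D$ is transitive if all vertices are. Source: no in-neighbors; sink: no out-neighbors. $\mathrm{Split}(D)$ has a vertex $\mathrm{out}(v)$ for each non-sink $v$ and a vertex $\mathrm{in}(w)$ for each non-source $w$ (all distinct), with $\mathrm{out}(v)\to\mathrm{in}(w)$ an arc iff $v\to w\in E(D)$, no other arcs. A diclique is a pair $(V,W)$ of nonempty vertex sets, written $V\to W$, with $v\to w$ an arc for all $v\in V$, $w\in W$; an arc $v\to w$ belongs to it if $v\in V$, $w\in W$. It is maximal if it is not properly contained (componentwise) in another diclique. An arc $v\to w$ is disimplicial if $x\to y$ is an arc for all in-neighbors $x$ of $w$ and out-neighbors $y$ of $v$. A reduced diclique is a maximal diclique containing a disimplicial arc. A digraph is weakly diclique irreducible (WDI) if every arc belongs to some reduced diclique. -}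

module Defs where

open import Data.Empty using (⊥)
open import Data.Fin using (Fin; zero; suc)
open import Data.Fin.Properties using (any?; +↔⊎)
open import Data.Irrelevant using ([_])
open import Data.Nat using (ℕ; zero; suc; _+_)
open import Data.Product using (∃; ∃!; ∃-syntax; _×_; _,_; proj₁; proj₂)
open import Data.Refinement using (Refinement; Refinement-syntax; _,_)
open import Data.Sum using (_⊎_; inj₁; inj₂)
open import Data.Sum.Function.Propositional using (_⊎-↔_)
open import Function using (_∘_)
open import Function.Bundles using (_↔_; mk↔ₛ′; module Inverse)
open import Function.Construct.Composition using (_↔-∘_)
open import Function.Construct.Symmetry using (↔-sym)
open import Level using (0ℓ)
open import Relation.Binary as B using (Rel)
open import Relation.Binary.PropositionalEquality
  using (_≡_; refl; sym; cong; subst)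
open import Relation.Nullary using (¬_; Dec; yes; no; contradiction; ¬?)
open import Relation.Nullary.Decidable using (map′)
open import Relation.Nullary.Negation using (contradiction-irr)
open import Relation.Unary as U using (Pred; _∈_; _⊆_; Satisfiable)

-- The vertex type is arbitrary, not always Fin n, so that Split D below can
-- have the vertices out v and in v literally.
record Digraph : Set₁ where
  infix 4 _⟶_ _⟶?_
  field
    Vertex : Set
    order  : ℕ
    finite : Vertex ↔ Fin order
    _⟶_    : Rel Vertex 0ℓ
    _⟶?_   : B.Decidable _⟶_

module _ (D : Digraph) where
  open Digraph D

  Reflexive : Set
  Reflexive = ∀ v → v ⟶ v

  Oriented : Set
  Oriented = ∀ v w → v ⟶ w → w ⟶ v → v ≡ w

  TransitiveVertex : Pred Vertex 0ℓ
  TransitiveVertex v = ∀ x y → x ⟶ v → v ⟶ y → x ⟶ y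

  Transitive : Set
  Transitive = ∀ v → TransitiveVertex v

  Source : Pred Vertex 0ℓ
  Source w = ¬ (∃[ v ] v ⟶ w)

  Sink : Pred Vertex 0ℓ
  Sink v = ¬ (∃[ w ] v ⟶ w)

  -- Vertex sets are decidable predicates, i.e. arbitrary subsets of the
  -- finite set of vertices.
  record Diclique : Set₁ where
    field
      tails          : Pred Vertex 0ℓ
      heads          : Pred Vertex 0ℓ
      tails?         : U.Decidable tails
      heads?         : U.Decidable heads
      tails-nonempty : Satisfiable tails
      heads-nonempty : Satisfiable heads
      complete       : ∀ {v w} → v ∈ tails → w ∈ heads → v ⟶ w

module _ {D : Digraph} where
  open Digraph D
  open Diclique

  infix 4 _⊑_ _⊏_

  _⊑_ : Diclique D → Diclique D → Set
  K ⊑ L = tails K ⊆ tails L × heads K ⊆ heads L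

  _⊏_ : Diclique D → Diclique D → Set
  K ⊏ L = K ⊑ L × ¬ (L ⊑ K)

  Maximal : Diclique D → Set₁
  Maximal K = ¬ (∃[ L ] K ⊏ L)

  -- Meant for v ⟶ w, which membership implies by completeness.
  Contains : Diclique D → Rel Vertex 0ℓ
  Contains K v w = v ∈ tails K × w ∈ heads K

module _ (D : Digraph) where
  open Digraph D

  Disimplicial : Rel Vertex 0ℓ
  Disimplicial v w = v ⟶ w × (∀ x y → x ⟶ w → v ⟶ y → x ⟶ y)

  Reduced : Diclique D → Set₁
  Reduced K = Maximal K × (∃[ v ] ∃[ w ] Disimplicial v w × Contains K v w)

  WDI : Set₁
  WDI = ∀ v w → v ⟶ w → ∃[ K ] Reduced K × Contains K v w

  -- A set M of arcs such that every vertex is an end of exactly one of them.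
  PerfectMatching : Rel Vertex 0ℓ → Set
  PerfectMatching M =
    (∀ v w → M v w → v ⟶ w) ×
    (∀ u → ∃! _≡_ λ ((v , w) : Vertex × Vertex) → M v w × (u ≡ v ⊎ u ≡ w))

private
  finite-refinement : ∀ {n} {P : Pred (Fin n) 0ℓ} → U.Decidable P →
                      ∃[ k ] [ i ∈ Fin n ∣ P i ] ↔ Fin k
  finite-refinement {zero} P? =
    0 , mk↔ₛ′ (λ { (() , _) }) (λ ()) (λ ()) (λ { (() , _) })
  finite-refinement {suc n} {P} P? with finite-refinement (P? ∘ suc) | P? zero
  ... | k , e | yes p = suc k , mk↔ₛ′ f g fg gf
    where
    open Inverse e

    skip : [ i ∈ Fin n ∣ P (suc i) ] → [ i ∈ Fin (suc n) ∣ P i ]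
    skip (i , q) = suc i , q

    f : [ i ∈ Fin (suc n) ∣ P i ] → Fin (suc k)
    f (zero  , q) = zero
    f (suc i , q) = suc (to (i , q))

    g : Fin (suc k) → [ i ∈ Fin (suc n) ∣ P i ]
    g zero    = zero , [ p ]
    g (suc j) = skip (from j)

    fg : ∀ j → f (g j) ≡ j
    fg zero    = refl
    fg (suc j) = cong suc (strictlyInverseˡ j)

    gf : ∀ i → g (f i) ≡ i
    gf (zero  , q) = refl
    gf (suc i , q) = cong skip (strictlyInverseʳ (i , q))
  ... | k , e | no ¬p = k , mk↔ₛ′ f (skip ∘ from) strictlyInverseˡ gf
    where
    open Inverse e

    skip : [ i ∈ Fin n ∣ P (suc i) ] → [ i ∈ Fin (suc n) ∣ P i ]
    skip (i , q) = suc i , q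

    f : [ i ∈ Fin (suc n) ∣ P i ] → Fin k
    f (zero  , [ q ]) = contradiction-irr q ¬p
    f (suc i , q)     = to (i , q)

    gf : ∀ i → skip (from (f i)) ≡ i
    gf (zero  , [ q ]) = contradiction-irr q ¬p
    gf (suc i , q)     = cong skip (strictlyInverseʳ (i , q))

  value-≡ : ∀ {A : Set} {P : Pred A 0ℓ} {r s : [ x ∈ A ∣ P x ]} →
            Refinement.value r ≡ Refinement.value s → r ≡ s
  value-≡ refl = refl

module _ (D : Digraph) where
  open Digraph D
  private module F = Inverse finite

  private
    finite-subset : {P : Pred Vertex 0ℓ} → U.Decidable P →
                    ∃[ k ] [ v ∈ Vertex ∣ P v ] ↔ Fin k
    finite-subset {P} P? =
      let k , e = finite-refinement (P? ∘ F.from) in k , e ↔-∘ index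
      where
      index : [ v ∈ Vertex ∣ P v ] ↔ [ i ∈ Fin order ∣ P (F.from i) ]
      index = mk↔ₛ′
        (λ { (v , [ p ]) → F.to v , [ subst P (sym (F.strictlyInverseʳ v)) p ] })
        (λ { (i , p) → F.from i , p })
        (λ { (i , _) → value-≡ (F.strictlyInverseˡ i) })
        (λ { (v , _) → value-≡ (F.strictlyInverseʳ v) })

    vertex-any? : {P : Pred Vertex 0ℓ} → U.Decidable P → Dec (∃ P)
    vertex-any? {P} P? = map′
      (λ (i , p) → F.from i , p)
      (λ (v , p) → F.to v , subst P (sym (F.strictlyInverseʳ v)) p)
      (any? (P? ∘ F.from))

    source? : U.Decidable (Source D)
    source? w = ¬? (vertex-any? (_⟶? w))

    sink? : U.Decidable (Sink D)
    sink? v = ¬? (vertex-any? (v ⟶?_))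

  -- inn stands for in, which is a keyword.  The proofs are irrelevant, so that
  -- there is at most one vertex out v and at most one vertex in v.
  data SplitVertex : Set where
    out : ∀ v → .(¬ Sink D v)   → SplitVertex
    inn : ∀ w → .(¬ Source D w) → SplitVertex

  SplitArc : Rel SplitVertex 0ℓ
  SplitArc (out v _) (inn w _) = v ⟶ w
  SplitArc (out _ _) (out _ _) = ⊥
  SplitArc (inn _ _) _         = ⊥

  private
    splitArc? : B.Decidable SplitArc
    splitArc? (out v _) (inn w _) = v ⟶? w
    splitArc? (out _ _) (out _ _) = no λ ()
    splitArc? (inn _ _) _         = no λ ()

    splitVertex-↔ : SplitVertex ↔
      ([ v ∈ Vertex ∣ ¬ Sink D v ] ⊎ [ w ∈ Vertex ∣ ¬ Source D w ])
    splitVertex-↔ = mk↔ₛ′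
      (λ { (out v p) → inj₁ (v , [ p ]) ; (inn w p) → inj₂ (w , [ p ]) })
      (λ { (inj₁ (v , [ p ])) → out v p ; (inj₂ (w , [ p ])) → inn w p })
      (λ { (inj₁ _) → refl ; (inj₂ _) → refl })
      (λ { (out _ _) → refl ; (inn _ _) → refl })

    outs : ∃[ k ] [ v ∈ Vertex ∣ ¬ Sink D v ] ↔ Fin k
    outs = finite-subset (¬? ∘ sink?)

    inns : ∃[ k ] [ w ∈ Vertex ∣ ¬ Source D w ] ↔ Fin k
    inns = finite-subset (¬? ∘ source?)

  Split : Digraph
  Split = record
    { Vertex = SplitVertex
    ; order  = proj₁ outs + proj₁ inns
    ; finite = ↔-sym +↔⊎ ↔-∘ ((proj₂ outs ⊎-↔ proj₂ inns) ↔-∘ splitVertex-↔)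
    ; _⟶_    = SplitArc
    ; _⟶?_   = splitArc?
    }

  reflexive⇒¬sink : Reflexive D → ∀ v → ¬ Sink D v
  reflexive⇒¬sink r v sink = sink (v , r v)

  reflexive⇒¬source : Reflexive D → ∀ v → ¬ Source D v
  reflexive⇒¬source r v source = source (v , r v)

  -- { out v ⟶ in v ∣ v a vertex of D }; reflexivity is what makes out v and
  -- in v vertices of Split D for every v.
  SplitMatching : Reflexive D → Rel SplitVertex 0ℓ
  SplitMatching r a b =
    ∃[ v ] a ≡ out v (reflexive⇒¬sink r v) × b ≡ inn v (reflexive⇒¬source r v)

{-# OPTIONS --safe #-}

-- A disimplicial arc v ⟶ w always lies in the reduced diclique whose tails are
-- the in-neighbors of w and whose heads are the out-neighbors of v.  In Split D,
-- an arc out v ⟶ in v is disimplicial iff v is transitive, and by reflexivity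
-- and antisymmetry there are no disimplicial arcs of another form.  Conversely,
-- a reduced diclique containing out v ⟶ in v and a disimplicial out x ⟶ in x
-- gives v ⟶ x and x ⟶ v, hence x ≡ v.
module Submission where

open import Data.Product using (_×_; _,_)
open import Data.Sum using (inj₁; inj₂)
open import Function.Bundles using (_⇔_; mk⇔)
open import Relation.Binary.PropositionalEquality using (refl)
open import Defs

module _ (D : Digraph) where
  open Digraph D
  open Diclique

  disimplicialDiclique : ∀ {v w} → Disimplicial D v w → Diclique D
  disimplicialDiclique {v} {w} (vw , dis) = record
    { tails          = _⟶ w
    ; heads          = v ⟶_
    ; tails?         = _⟶? w
    ; heads?         = v ⟶?_
    ; tails-nonempty = v , vw
    ; heads-nonempty = w , vw
    ; complete       = dis _ _
    }

  -- Any diclique `L` above this one still contains `v ⟶ w`, so completeness of `L` makes its tails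
  -- in-neighbors of `w` and its heads out-neighbors of `v`.
  disimplicialDiclique-reduced : ∀ {v w} (d : Disimplicial D v w) →
                                 Reduced D (disimplicialDiclique d)
  disimplicialDiclique-reduced d@(vw , _) =
    (λ (L , (t , h) , L⋢K) →
       L⋢K ((λ a∈L → complete L a∈L (h vw)) , (λ b∈L → complete L (t vw) b∈L))) ,
    (_ , _ , d , vw , vw)

module _ (D : Digraph) (r : Reflexive D) where
  open Digraph D

  outᵣ innᵣ : Vertex → SplitVertex D
  outᵣ v = out v (reflexive⇒¬sink D r v)
  innᵣ v = inn v (reflexive⇒¬source D r v)

  transitiveVertex⇒disimplicial :
    ∀ {v} → TransitiveVertex D v → Disimplicial (Split D) (outᵣ v) (innᵣ v)
  transitiveVertex⇒disimplicial {v} t = r v , λ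
    { (out x _) (inn y _) xv vy → t x y xv vy
    ; (out _ _) (out _ _) _ ()
    ; (inn _ _) _ ()
    }

  disimplicial⇒transitiveVertex :
    ∀ {v} → Disimplicial (Split D) (outᵣ v) (innᵣ v) → TransitiveVertex D v
  disimplicial⇒transitiveVertex (_ , dis) x y = dis (outᵣ x) (innᵣ y)

  transitive⇒WDI : Transitive D → WDI (Split D)
  transitive⇒WDI t (out v _) (inn w _) vw =
    disimplicialDiclique (Split D) d ,
    disimplicialDiclique-reduced (Split D) d ,
    -- The loop at `v` puts `outᵣ v` among the tails, so the diclique of the matching arc at `v`
    -- covers all arcs leaving `out v`.
    r v , vw
    where d = transitiveVertex⇒disimplicial (t v)

  splitMatching-perfect : PerfectMatching (Split D) (SplitMatching D r)
  splitMatching-perfect = (λ { _ _ (v , refl , refl) → r v }) , λ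
    -- Proof irrelevance makes any `out v _` definitionally `outᵣ v`, and likewise for `inn`, so
    -- `refl` suffices.
    { (out v _) → (outᵣ v , innᵣ v) , ((v , refl , refl) , inj₁ refl) , λ
      { ((_ , refl , refl) , inj₁ refl) → refl
      ; ((_ , refl , refl) , inj₂ ())
      }
    ; (inn v _) → (outᵣ v , innᵣ v) , ((v , refl , refl) , inj₂ refl) , λ
      { ((_ , refl , refl) , inj₁ ())
      ; ((_ , refl , refl) , inj₂ refl) → refl
      }
    }

  module _ (o : Oriented D) where
    open Diclique

    disimplicial⇒matching :
      ∀ a b → Disimplicial (Split D) a b → SplitMatching D r a b
    disimplicial⇒matching (out x _) (inn y _) (xy , dis)
      -- The loops at `y` and `x`, fed to disimpliciality, give the reverse arc `y ⟶ x`.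
      with refl ← o x y xy (dis (outᵣ y) (innᵣ x) (r y) (r x)) = x , refl , refl

    WDI⇒disimplicial :
      WDI (Split D) → ∀ v → Disimplicial (Split D) (outᵣ v) (innᵣ v)
    WDI⇒disimplicial wdi v
      with K , (_ , a , b , dis , a∈K , b∈K) , v∈tails , v∈heads
             ← wdi (outᵣ v) (innᵣ v) (r v)
      with x , refl , refl ← disimplicial⇒matching a b dis
      -- Pairing the tail of each arc with the head of the other identifies `x` with `v`, so `dis`
      -- is already the goal.
      with refl ← o v x (complete K v∈tails b∈K) (complete K a∈K v∈heads) = dis

theorem13 : (D : Digraph) (r : Reflexive D) → Oriented D →
    (Transitive D ⇔ WDI (Split D)) ×
    PerfectMatching (Split D) (SplitMatching D r) ×
    (WDI (Split D) → ∀ a b → SplitMatching D r a b ⇔ Disimplicial (Split D) a b)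
theorem13 D r o =
  mk⇔ (transitive⇒WDI D r)
      (λ wdi v → disimplicial⇒transitiveVertex D r (WDI⇒disimplicial D r o wdi v)) ,
  splitMatching-perfect D r ,
  λ wdi a b → mk⇔
    (λ { (v , refl , refl) → WDI⇒disimplicial D r o wdi v })
    (disimplicial⇒matching D r o a b)
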